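{- (a) Let $n \ge 7$ and let $a$ be an integer with $a^2 - a + 1 \equiv 0 \pmod n$ such that $TL_n(a,a-1,1)$ is a 6-valent first-kind Frobenius circulant (with cyclic kernel). Then $TL_n(a,a-1,1)$ is isomorphic to $EJ_\alpha$ for some $\alpha = c + d\rho \in \mathbb{Z}[\rho]$ with $\gcd(c,d) = 1$. Moreover, letting $k$ be the integer with $a^2 - a + 1 = kn$, $\alpha$ is equal to $(rn+m) + (sn - ma)\rho$, or $(rn+m) + (sn + m(a-1))\rho$, or $(rn+ma) + (sn - m(a-1))\rho$, where $(m,r,s)$ is an integer solution of, respectively, $km^2 - [(a-2)r + (2a-1)s]m + (r^2+rs+s^2)n = 1$, $km^2 + [(a+1)r + (2a-1)s]m + (r^2+rs+s^2)n = 1$, $km^2 + [(a+1)r - (a-2)s]m + (r^2+rs+s^2)n = 1$. (b) Let $\alpha = c + d\rho \in \mathbb{Z}[\rho]$ with $N(\alpha) \ge 7$ and $\gcd(c,d) = 1$. Then $EJ_\alpha$ is isomorphic to a 6-valent first-kind Frobenius circulant if and only if $N(\alpha) \equiv 1 \pmod 6$.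
   Context: $\rho = (1+\sqrt{ -3})/2$; $\mathbb{Z}[\rho] = \{x+y\rho : x,y\in\mathbb{Z}\}$ is the ring of Eisenstein-Jacobi integers with norm $N(x+y\rho) = x^2+xy+y^2$. For $0 \ne \alpha\in\mathbb{Z}[\rho]$ with $N(\alpha)\ge 7$, the Eisenstein-Jacobi graph $EJ_\alpha$ is the Cayley graph on the additive group of $\mathbb{Z}[\rho]/(\alpha)$ with connection set $\{\pm[1]_\alpha, \pm[\rho]_\alpha, \pm[\rho^2]_\alpha\}$ ($[\eta]_\alpha$ the residue class of $\eta$ modulo $\alpha$). For integers $1\le a,b,c\le n-1$ with $a,b,c,n-a,n-b,n-c$ pairwise distinct, $TL_n(a,b,c)$ is the Cayley graph on $\mathbb{Z}_n$ with connection set $\{\pm[a],\pm[b],\pm[c]\}$. A Frobenius group is a transitive, non-regular permutation group on a finite set in which only the identity fixes two points; it is $K\rtimes H$ with regular normal Frobenius kernel $K$ and point stabiliser $H$ acting on $K$ by conjugation. A first-kind Frobenius graph is $\mathrm{Cay}(K,a^H)$ with $\langle a^H\rangle=K$ and $|H|$ even or $a$ an involution. A 6-valent first-kind Frobenius circulant means such a 6-valent graph with cyclic kernel $K \cong \mathbb{Z}_n$. -}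

module Defs where

open import Data.Nat as ℕ using (ℕ)
open import Data.Integer using (ℤ; +_; -_; _+_; _-_; _*_; _≤_)
open import Data.Integer.Divisibility using (_∣_)
open import Data.Product using (Σ; ∃; _×_; _,_)
open import Data.Sum using (_⊎_)
open import Data.List using (List; []; _∷_; map; length; zipWith; foldr)
open import Data.List.Membership.Propositional using (_∈_)
open import Data.List.Relation.Unary.Any using (Any)
open import Data.List.Relation.Unary.AllPairs using (AllPairs)
open import Relation.Binary.PropositionalEquality using (_≡_)
open import Relation.Nullary using (¬_)

Congr : ℕ → ℤ → ℤ → Set
Congr n x y = (+ n) ∣ (x - y)

-- Graphs whose vertex set is a type modulo an equivalence relation
-- (a quotient such as ℤ/nℤ or ℤ[ρ]/(α) is represented by representatives
-- together with the congruence relation).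

record Graph : Set₁ where
  field
    V   : Set
    _≈_ : V → V → Set
    Adj : V → V → Set

record _≅_ (G G′ : Graph) : Set where
  field
    f      : Graph.V G → Graph.V G′
    f-cong : ∀ {x y} → Graph._≈_ G x y → Graph._≈_ G′ (f x) (f y)
    f-inj  : ∀ {x y} → Graph._≈_ G′ (f x) (f y) → Graph._≈_ G x y
    f-surj : ∀ y → ∃ λ x → Graph._≈_ G′ (f x) y
    f-adj  : ∀ x y → Graph.Adj G x y → Graph.Adj G′ (f x) (f y)
    f-adj⁻ : ∀ x y → Graph.Adj G′ (f x) (f y) → Graph.Adj G x y

Circulant : ℕ → List ℤ → Graph
Circulant n S = record
  { V   = ℤ
  ; _≈_ = Congr n
  ; Adj = λ x y → Any (λ s → Congr n (y - x) s) S
  }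

TL : ℕ → ℤ → ℤ → ℤ → Graph
TL n a b c = Circulant n (a ∷ - a ∷ b ∷ - b ∷ c ∷ - c ∷ [])

-- The side condition in the definition of TL_n(a,b,c): the residues
-- a, b, c, -a, -b, -c (i.e. n-a, n-b, n-c) are pairwise distinct mod n
-- and nonzero (1 ≤ a,b,c ≤ n-1 after reduction mod n).
TLWellDefined : ℕ → ℤ → ℤ → ℤ → Set
TLWellDefined n a b c =
  AllPairs (λ x y → ¬ Congr n x y) (a ∷ b ∷ c ∷ - a ∷ - b ∷ - c ∷ [])
  × ¬ Congr n a (+ 0) × ¬ Congr n b (+ 0) × ¬ Congr n c (+ 0)

CardMod : ℕ → List ℤ → ℕ → Set
CardMod n L k = Σ (List ℤ) λ R →
    length R ≡ k
  × AllPairs (λ x y → ¬ Congr n x y) R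
  × (∀ {x} → x ∈ L → Any (Congr n x) R)
  × (∀ {r} → r ∈ R → Any (Congr n r) L)

InSubgroupGen : ℕ → List ℤ → ℤ → Set
InSubgroupGen n L x = Σ (List ℤ) λ cs →
  length cs ≡ length L × Congr n x (foldr _+_ (+ 0) (zipWith _*_ cs L))

-- Frobenius groups with cyclic kernel ℤ_n.
--
-- A Frobenius group K ⋊ H with K ≅ ℤ_n: H acts (faithfully, by
-- conjugation) as a group of automorphisms of ℤ_n, i.e. as a subgroup of
-- the unit group ℤ_n^*, given here by a list of representatives.  The
-- group G = ℤ_n ⋊ H acts on ℤ_n as the affine maps x ↦ h x + t
-- (h ∈ H, t ∈ ℤ_n); the kernel K is the translation subgroup and H the
-- stabiliser of 0.  The defining conditions of a Frobenius group
-- (transitive, non-regular, only the identity fixes two points) are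
-- stated literally for this action.  The affine map (h , t) is the
-- identity map of ℤ_n iff h ≡ 1 and t ≡ 0.

IsUnitSubgroup : ℕ → List ℤ → Set
IsUnitSubgroup n H =
    Any (λ h → Congr n h (+ 1)) H
  × (∀ {h h′} → h ∈ H → h′ ∈ H → Any (Congr n (h * h′)) H)
  × (∀ {h} → h ∈ H → ∃ λ u → Congr n (h * u) (+ 1))

IsFrobeniusAffine : ℕ → List ℤ → Set
IsFrobeniusAffine n H =
    (∀ x y → Σ ℤ λ h → h ∈ H × Σ ℤ λ t → Congr n (h * x + t) y)
  × (Σ ℤ λ h → h ∈ H × Σ ℤ λ t → Σ ℤ λ x →
        ¬ (Congr n h (+ 1) × Congr n t (+ 0)) × Congr n (h * x + t) x)
  × (∀ {h} → h ∈ H → ∀ t x y → ¬ Congr n x y →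
        Congr n (h * x + t) x → Congr n (h * y + t) y →
        Congr n h (+ 1) × Congr n t (+ 0))

-- orbit a^H of a ∈ K = ℤ_n under H (conjugation of the translation by a
-- by the element x ↦ h x gives the translation by h a)
orbit : List ℤ → ℤ → List ℤ
orbit H a = map (λ h → h * a) H

record FrobCirc6 : Set where
  field
    n       : ℕ
    n≥1     : 1 ℕ.≤ n
    H       : List ℤ
    a       : ℤ
    H-grp   : IsUnitSubgroup n H
    frob    : IsFrobeniusAffine n H
    gen     : ∀ x → InSubgroupGen n (orbit H a) x
    kind1   : (Σ ℕ λ j → CardMod n H (2 ℕ.* j))
              ⊎ (¬ Congr n a (+ 0) × Congr n (a + a) (+ 0))
    val6    : CardMod n (orbit H a) 6

FrobGraph : FrobCirc6 → Graph
FrobGraph F = Circulant (FrobCirc6.n F) (orbit (FrobCirc6.H F) (FrobCirc6.a F))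

IsFrobCirc6 : Graph → Set
IsFrobCirc6 G = Σ FrobCirc6 λ F → G ≅ FrobGraph F

-- Eisenstein–Jacobi integers ℤ[ρ], ρ = (1 + √-3)/2, ρ² = ρ - 1.

record ℤρ : Set where
  constructor _+_ρ
  field
    re : ℤ
    im : ℤ

infix 8 _+_ρ

_+ᴱ_ : ℤρ → ℤρ → ℤρ
(x + y ρ) +ᴱ (u + v ρ) = (x + u) + (y + v) ρ

-ᴱ_ : ℤρ → ℤρ
-ᴱ (x + y ρ) = (- x) + (- y) ρ

_-ᴱ_ : ℤρ → ℤρ → ℤρ
α -ᴱ β = α +ᴱ (-ᴱ β)

-- (x + yρ)(u + vρ) = xu + (xv + yu)ρ + yv ρ² = (xu - yv) + (xv + yu + yv)ρ
_*ᴱ_ : ℤρ → ℤρ → ℤρ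
(x + y ρ) *ᴱ (u + v ρ) = (x * u - y * v) + (x * v + y * u + y * v) ρ

N : ℤρ → ℤ
N (x + y ρ) = x * x + x * y + y * y

CongrE : ℤρ → ℤρ → ℤρ → Set
CongrE α β γ = ∃ λ q → β -ᴱ γ ≡ α *ᴱ q

-- ±1, ±ρ, ±ρ²   (ρ² = -1 + ρ)
unitsE : List ℤρ
unitsE = (+ 1) + (+ 0) ρ ∷ (- + 1) + (+ 0) ρ
       ∷ (+ 0) + (+ 1) ρ ∷ (+ 0) + (- + 1) ρ
       ∷ (- + 1) + (+ 1) ρ ∷ (+ 1) + (- + 1) ρ ∷ []

EJ : ℤρ → Graph
EJ α = record
  { V   = ℤρ
  ; _≈_ = CongrE α
  ; Adj = λ β γ → Any (λ u → CongrE α (γ -ᴱ β) u) unitsE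
  }

-- A root b of x² - x + 1 modulo n gives a ring homomorphism φ : ℤ[ρ] → ℤ/n,
-- ρ ↦ b.  If φ kills α and N(α) = n, its kernel is (α), so φ identifies EJ_α
-- with the circulant whose connection set is the image of the six units.
--
-- For (a), b = 1 - a, and m + (s n - m a) ρ always lies in the kernel; its norm
-- is n times the value at (s, m) of the form n x² - (2a-1) x y + k y², which has
-- discriminant -3 and therefore represents 1.  Hence r = 0 suffices and α can
-- always be taken of the first of the three shapes.
--
-- For (b), Bézout coefficients of (c, d) provide b.  If n ≡ 1 (mod 6), the images
-- of the units form a Frobenius complement, since differences of distinct units
-- have norm 1, 3 or 4.  Conversely, if 3 divided the order of a cyclic Frobenius
-- kernel, a complement could contain only 1 and one further element; so 3 ∤ n,
-- and then n = c² + cd + d² with c, d coprime forces n ≡ 1 (mod 6).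

module Submission where

open import Defs
open import Data.Nat as ℕ using (ℕ; zero; suc; z≤n; s≤s)
import Data.Nat.Properties as ℕ
import Data.Nat.Divisibility as ℕ
import Data.Nat.GCD as ℕ
open import Data.Nat.Coprimality using (gcd≡1⇒coprime; coprime-Bézout)
open import Data.Nat.Induction using (<-wellFounded)
open import Data.Integer using (ℤ; +_; -_; _+_; _-_; _*_; _≤_; ∣_∣; -[1+_]; +≤+; _≟_)
open import Data.Integer.Properties
open import Data.Integer.DivMod using (_%ℕ_; _/ℕ_; n%ℕd<d; a≡a%ℕn+[a/ℕn]*n)
open import Data.Integer.Divisibility.Signed as Signed
  using (divides; ∣⇒∣ᵤ; ∣ᵤ⇒∣)
  renaming (_∣_ to _∣ₛ_; _∣?_ to _∣ₛ?_)
open import Data.Integer.GCD using (gcd; gcd[i,j]∣i; gcd[i,j]∣j)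
open import Data.Integer.Tactic.RingSolver using (solve-∀)
open import Data.Fin as Fin using (Fin; toℕ; fromℕ<)
import Data.Fin.Properties as Fin
open import Data.List using (List; []; _∷_; map)
open import Data.List.Properties using (map-id; map-cong)
open import Data.List.Membership.Propositional using (_∈_)
open import Data.List.Membership.Propositional.Properties using (∈-map⁻)
open import Data.List.Relation.Unary.All as All using (All)
open import Data.List.Relation.Unary.Any as Any using (Any; here; there)
import Data.List.Relation.Unary.Any.Properties as Any
open import Data.List.Relation.Unary.AllPairs as AllPairs using (AllPairs; []; _∷_)
import Data.List.Relation.Unary.AllPairs.Properties as AllPairs
open import Data.List.Relation.Binary.Subset.Propositional using (_⊆_)
open import Data.List.Relation.Binary.Subset.Propositional.Properties using (Any-resp-⊆)
open import Data.Product using (Σ; ∃; ∃₂; _×_; _,_; proj₁; proj₂)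
open import Data.Sum using (_⊎_; inj₁; inj₂)
open import Data.Empty using (⊥)
open import Function.Base using (_∘_)
open import Function.Bundles using (_⇔_; mk⇔)
open import Induction.WellFounded using (Acc; acc)
open import Relation.Binary.Definitions using (DecidableEquality)
open import Relation.Binary.PropositionalEquality
open import Relation.Nullary using (¬_; contradiction)
open import Relation.Nullary.Decidable using (toWitness; map′; _×-dec_; _⊎-dec_)

open ≡-Reasoning

-- Congruence modulo `n` with signed quotients

infix 4 _≋_mod_

-- `Congr` unfolds to divisibility of absolute values, from which unification cannot recover `x` and
-- `y`. Here both stay visible as indices, and the signed quotient turns congruences into ring
-- identities.
record _≋_mod_ (x y : ℤ) (n : ℕ) : Set where
  constructor by
  field
    quotient : ℤ
    equality : x - y ≡ quotient * + n

Congr⇒≋ : ∀ n x y → Congr n x y → x ≋ y mod n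
Congr⇒≋ n x y n∣x-y with ∣ᵤ⇒∣ {+ n} {x - y} n∣x-y
... | divides q eq = by q eq

≋⇒Congr : ∀ {n x y} → x ≋ y mod n → Congr n x y
≋⇒Congr {n} {x} {y} (by q eq) = ∣⇒∣ᵤ {+ n} {x - y} (divides q eq)

module _ {n : ℕ} where

  ≋-refl : ∀ {x} → x ≋ x mod n
  ≋-refl {x} = by (+ 0) (+-inverseʳ x)

  ≋-reflexive : ∀ {x y} → x ≡ y → x ≋ y mod n
  ≋-reflexive refl = ≋-refl

  ≋-sym : ∀ {x y} → x ≋ y mod n → y ≋ x mod n
  ≋-sym {x} {y} (by q eq) = by (- q) (begin
    y - x        ≡⟨ lemma x y ⟩
    - (x - y)    ≡⟨ cong -_ eq ⟩
    - (q * + n)  ≡⟨ neg-distribˡ-* q (+ n) ⟩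
    - q * + n    ∎)
    where
    lemma : ∀ x y → y - x ≡ - (x - y)
    lemma = solve-∀

  ≋-trans : ∀ {x y z} → x ≋ y mod n → y ≋ z mod n → x ≋ z mod n
  ≋-trans {x} {y} {z} (by p eq) (by q eq′) = by (p + q) (begin
    x - z                ≡⟨ lemma x y z ⟩
    (x - y) + (y - z)    ≡⟨ cong₂ _+_ eq eq′ ⟩
    p * + n + q * + n    ≡⟨ *-distribʳ-+ (+ n) p q ⟨
    (p + q) * + n        ∎)
    where
    lemma : ∀ x y z → x - z ≡ (x - y) + (y - z)
    lemma = solve-∀

  ≋-*ʳ : ∀ {x y} z → x ≋ y mod n → (x * z) ≋ (y * z) mod n
  ≋-*ʳ {x} {y} z (by q eq) = by (q * z) (begin
    x * z - y * z    ≡⟨ lemma x y z ⟩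
    (x - y) * z      ≡⟨ cong (_* z) eq ⟩
    q * + n * z      ≡⟨ lemma′ q (+ n) z ⟩
    q * z * + n      ∎)
    where
    lemma : ∀ x y z → x * z - y * z ≡ (x - y) * z
    lemma = solve-∀
    lemma′ : ∀ q n z → q * n * z ≡ q * z * n
    lemma′ = solve-∀

  ≋-*ˡ : ∀ {x y} z → x ≋ y mod n → (z * x) ≋ (z * y) mod n
  ≋-*ˡ {x} {y} z rewrite *-comm z x | *-comm z y = ≋-*ʳ z

≋-mono-∣ : ∀ {m n x y} → m ℕ.∣ n → x ≋ y mod n → x ≋ y mod m
≋-mono-∣ {m} (ℕ.divides p refl) (by q eq) =
  by (q * + p) (trans eq (trans (cong (q *_) (pos-* p m)) (sym (*-assoc q (+ p) (+ m)))))

%ℕ-≋ : ∀ n x .{{_ : ℕ.NonZero n}} → x ≋ + (x %ℕ n) mod n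
%ℕ-≋ n x = by (x /ℕ n) (trans (cong (_- r) (a≡a%ℕn+[a/ℕn]*n x n)) (lemma r (x /ℕ n * + n)))
  where
  r = + (x %ℕ n)
  lemma : ∀ r y → r + y - r ≡ y
  lemma = solve-∀

≋⇒≡ : ∀ {n i j} → i ℕ.< n → j ℕ.< n → (+ i) ≋ (+ j) mod n → i ≡ j
≋⇒≡ {n} {i} {j} i<n j<n i≋j = +-injective (i-j≡0⇒i≡j (+ i) (+ j) (∣i∣≡0⇒i≡0 (vanish _ small (≋⇒Congr i≋j))))
  where
  small : ∣ + i - + j ∣ ℕ.< n
  small = ℕ.≤-<-trans
    (subst (λ z → ∣ z ∣ ℕ.≤ i ℕ.⊔ j) (sym (m-n≡m⊖n i j)) (∣m⊝n∣≤m⊔n i j))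
    (ℕ.⊔-pres-<m i<n j<n)
  vanish : ∀ z → z ℕ.< n → n ℕ.∣ z → z ≡ 0
  vanish zero    _   _   = refl
  vanish (suc z) z<n n∣z = contradiction n∣z (ℕ.>⇒∤ z<n)

-- Compares orders of quotients through an injection of finite sets. As `f` only has to reflect
-- congruence, a choice of preimages under a surjection qualifies.
residue-injection⇒≤ : ∀ {m n} .{{_ : ℕ.NonZero m}} (f : ℤ → ℤ) →
  (∀ x y → f x ≋ f y mod m → x ≋ y mod n) → n ℕ.≤ m
residue-injection⇒≤ {m} {n} f f-inj = Fin.injective⇒≤ {f = g} g-inj
  where
  g : Fin n → Fin m
  g i = fromℕ< (n%ℕd<d (f (+ toℕ i)) m)
  g-inj : ∀ {i j} → g i ≡ g j → i ≡ j
  g-inj {i} {j} gi≡gj = Fin.toℕ-injective (≋⇒≡ (Fin.toℕ<n i) (Fin.toℕ<n j) (f-inj _ _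
    (≋-trans (%ℕ-≋ m _) (≋-trans (≋-reflexive (cong +_ residues)) (≋-sym (%ℕ-≋ m _))))))
    where
    residues : f (+ toℕ i) %ℕ m ≡ f (+ toℕ j) %ℕ m
    residues = Fin.fromℕ<-injective _ _ _ _ gi≡gj

-- Binary quadratic forms of discriminant -3

-- Replacing b by its residue r modulo A gives A C′ = r² - r + 1 < A², so C′ < A.
represents-one : ∀ A → Acc ℕ._<_ A → .{{_ : ℕ.NonZero A}} → ∀ b C →
  b * b - b + + 1 ≡ C * + A →
  ∃₂ λ x y → + A * x * x - (+ 2 * b - + 1) * x * y + C * y * y ≡ + 1
represents-one 1 _ b C _ = + 1 , + 0 , lemma b C
  where
  lemma : ∀ b C → + 1 * + 1 * + 1 - (+ 2 * b - + 1) * + 1 * + 0 + C * + 0 * + 0 ≡ + 1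
  lemma = solve-∀
represents-one A@(suc (suc A″)) (acc rec) b C eq = conclude C′ refl
  where
  r = b %ℕ A
  q = b /ℕ A
  -- Replacing `x` by `x + q * y` in the form with coefficients `A`, `b`, `C` gives the form with
  -- coefficients `A`, `r`, `C′`.
  C′ = C - (+ 2 * b - + 1) * q + + A * q * q

  -- This is r² - r + 1 over ℕ, correct also for `r = 0`. The outer `suc` makes it visibly positive,
  -- which refutes `C′ ≤ 0` in `conclude`.
  P = suc (r ℕ.* ℕ.pred r)

  P≡ : + P ≡ + r * + r - + r + + 1
  P≡ with r
  ... | zero  = refl
  ... | suc j = begin
    + (suc (suc j ℕ.* j))                     ≡⟨ pos-+ 1 (suc j ℕ.* j) ⟩
    + 1 + + (suc j ℕ.* j)                     ≡⟨ cong (λ z → + 1 + z) (pos-* (suc j) j) ⟩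
    + 1 + (+ 1 + + j) * + j                   ≡⟨ lemma (+ j) ⟩
    (+ 1 + + j) * (+ 1 + + j) - (+ 1 + + j) + + 1 ∎
    where
    lemma : ∀ j → + 1 + (+ 1 + j) * j ≡ (+ 1 + j) * (+ 1 + j) - (+ 1 + j) + + 1
    lemma = solve-∀

  r≡ : + r ≡ b - q * + A
  r≡ = begin
    + r                              ≡⟨ lemma (+ r) (q * + A) ⟩
    + r + q * + A - q * + A          ≡⟨ cong (_- q * + A) (a≡a%ℕn+[a/ℕn]*n b A) ⟨
    b - q * + A                      ∎
    where
    lemma : ∀ r y → r ≡ r + y - y
    lemma = solve-∀

  C′A≡P : C′ * + A ≡ + P
  C′A≡P = begin
    C′ * + A ≡⟨ lemma C b q (+ A) ⟩
    C * + A + (q * + A * q * + A - (+ 2 * b - + 1) * (q * + A))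
      ≡⟨ cong (_+ (q * + A * q * + A - (+ 2 * b - + 1) * (q * + A))) eq ⟨
    b * b - b + + 1 + (q * + A * q * + A - (+ 2 * b - + 1) * (q * + A))
      ≡⟨ lemma′ b q (+ A) ⟩
    (b - q * + A) * (b - q * + A) - (b - q * + A) + + 1
      ≡⟨ cong (λ z → z * z - z + + 1) r≡ ⟨
    + r * + r - + r + + 1 ≡⟨ P≡ ⟨
    + P ∎
    where
    lemma : ∀ C b q A → (C - (+ 2 * b - + 1) * q + A * q * q) * A ≡ C * A + (q * A * q * A - (+ 2 * b - + 1) * (q * A))
    lemma = solve-∀
    lemma′ : ∀ b q A → b * b - b + + 1 + (q * A * q * A - (+ 2 * b - + 1) * (q * A)) ≡ (b - q * A) * (b - q * A) - (b - q * A) + + 1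
    lemma′ = solve-∀

  P<AA : P ℕ.< A ℕ.* A
  P<AA = s≤s (ℕ.≤-<-trans
    (ℕ.*-mono-≤ r≤ (ℕ.pred-mono-≤ r≤))
    (ℕ.<-≤-trans (ℕ.*-monoʳ-< (suc A″) (ℕ.n<1+n A″))
      (ℕ.≤-trans (ℕ.*-monoʳ-≤ (suc A″) (ℕ.n≤1+n (suc A″))) (ℕ.m≤n+m _ (suc A″)))))
    where
    r≤ : r ℕ.≤ suc A″
    r≤ = ℕ.≤-pred (n%ℕd<d b A)

  conclude : ∀ D → C′ ≡ D →
    ∃₂ λ x y → + A * x * x - (+ 2 * b - + 1) * x * y + C * y * y ≡ + 1
  conclude (+ zero) e = contradiction (trans (cong (_* + A) (sym e)) C′A≡P) λ ()
  conclude -[1+ _ ] e = contradiction (trans (cong (_* + A) (sym e)) C′A≡P) λ ()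
  -- The recursive solution belongs to the reduced form with its outer coefficients swapped.
  -- Swapping `x` and `y` back and undoing the shift by `q` gives this witness.
  conclude (+ suc D) e = y + q * x , x , (begin
    + A * (y + q * x) * (y + q * x) - (+ 2 * b - + 1) * (y + q * x) * x + C * x * x
      ≡⟨ lemma (+ A) b C q x y ⟩
    C′ * x * x - (+ 2 * (b - q * + A) - + 1) * x * y + + A * y * y
      ≡⟨ cong₂ (λ u v → u * x * x - (+ 2 * v - + 1) * x * y + + A * y * y) e (sym r≡) ⟩
    + suc D * x * x - (+ 2 * + r - + 1) * x * y + + A * y * y
      ≡⟨ form≡1 ⟩
    + 1 ∎)
    where
    DA≡P : suc D ℕ.* A ≡ P
    DA≡P = +-injective (trans (pos-* (suc D) A) (trans (cong (_* + A) (sym e)) C′A≡P))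
    D<A : suc D ℕ.< A
    D<A = ℕ.*-cancelʳ-< A (suc D) A (subst (ℕ._< A ℕ.* A) (sym DA≡P) P<AA)
    smaller : ∃₂ λ x y → + suc D * x * x - (+ 2 * + r - + 1) * x * y + + A * y * y ≡ + 1
    smaller = represents-one (suc D) (rec D<A) (+ r) (+ A)
      (trans (sym P≡) (trans (sym C′A≡P) (trans (cong (_* + A) e) (*-comm (+ suc D) (+ A)))))
    x = proj₁ smaller
    y = proj₁ (proj₂ smaller)
    form≡1 = proj₂ (proj₂ smaller)
    lemma : ∀ A b C q x y →
      A * (y + q * x) * (y + q * x) - (+ 2 * b - + 1) * (y + q * x) * x + C * x * x
      ≡ (C - (+ 2 * b - + 1) * q + A * q * q) * x * x - (+ 2 * (b - q * A) - + 1) * x * y + A * y * y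
    lemma = solve-∀

-- Bézout coefficients over the integers

∣i∣≡σ*i : ∀ i → ∃ λ σ → + ∣ i ∣ ≡ σ * i
∣i∣≡σ*i (+ n)    = + 1 , sym (*-identityˡ (+ n))
∣i∣≡σ*i -[1+ n ] = - + 1 , sym (-1*i≡-i -[1+ n ])

bézout : ∀ c d → gcd c d ≡ + 1 → ∃₂ λ u v → u * c + v * d ≡ + 1
bézout c d gcd≡1 with coprime-Bézout (gcd≡1⇒coprime (+-injective gcd≡1)) | ∣i∣≡σ*i c | ∣i∣≡σ*i d
... | ℕ.Bézout.+- x y eq | σ , ∣c∣≡ | τ , ∣d∣≡ = + x * σ , - + y * τ , (begin
    + x * σ * c + - + y * τ * d      ≡⟨ lemma (+ x) σ c (+ y) τ d ⟩
    + x * (σ * c) - + y * (τ * d)    ≡⟨ cong₂ (λ p q → + x * p - + y * q) ∣c∣≡ ∣d∣≡ ⟨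
    + x * + ∣ c ∣ - + y * + ∣ d ∣    ≡⟨ cong₂ (λ p q → p - q) (pos-* x ∣ c ∣) (pos-* y ∣ d ∣) ⟨
    + (x ℕ.* ∣ c ∣) - + (y ℕ.* ∣ d ∣) ≡⟨ cong (λ z → + z - + (y ℕ.* ∣ d ∣)) eq ⟨
    + 1 + + (y ℕ.* ∣ d ∣) - + (y ℕ.* ∣ d ∣) ≡⟨ lemma′ (+ (y ℕ.* ∣ d ∣)) ⟩
    + 1 ∎)
    where
    lemma : ∀ x σ c y τ d → x * σ * c + - y * τ * d ≡ x * (σ * c) - y * (τ * d)
    lemma = solve-∀
    lemma′ : ∀ z → + 1 + z - z ≡ + 1
    lemma′ = solve-∀
... | ℕ.Bézout.-+ x y eq | σ , ∣c∣≡ | τ , ∣d∣≡ = - + x * σ , + y * τ , (begin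
    - + x * σ * c + + y * τ * d      ≡⟨ lemma (+ x) σ c (+ y) τ d ⟩
    + y * (τ * d) - + x * (σ * c)    ≡⟨ cong₂ (λ p q → + y * q - + x * p) ∣c∣≡ ∣d∣≡ ⟨
    + y * + ∣ d ∣ - + x * + ∣ c ∣    ≡⟨ cong₂ (λ p q → p - q) (pos-* y ∣ d ∣) (pos-* x ∣ c ∣) ⟨
    + (y ℕ.* ∣ d ∣) - + (x ℕ.* ∣ c ∣) ≡⟨ cong (λ z → + z - + (x ℕ.* ∣ c ∣)) eq ⟨
    + 1 + + (x ℕ.* ∣ c ∣) - + (x ℕ.* ∣ c ∣) ≡⟨ lemma′ (+ (x ℕ.* ∣ c ∣)) ⟩
    + 1 ∎)
    where
    lemma : ∀ x σ c y τ d → - x * σ * c + y * τ * d ≡ y * (τ * d) - x * (σ * c)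
    lemma = solve-∀
    lemma′ : ∀ z → + 1 + z - z ≡ + 1
    lemma′ = solve-∀

-- Conjugation, norm and units in ℤ[ρ]

_≟ᴱ_ : DecidableEquality ℤρ
(x + y ρ) ≟ᴱ (u + v ρ) = map′ (λ (p , q) → cong₂ _+_ρ p q) (λ { refl → refl , refl }) (x ≟ u ×-dec y ≟ v)

-- Complex conjugation, which sends ρ to 1 - ρ.
conj : ℤρ → ℤρ
conj (x + y ρ) = (x + y) + (- y) ρ

*ᴱ-conj : ∀ α → α *ᴱ conj α ≡ N α + (+ 0) ρ
*ᴱ-conj (x + y ρ) = cong₂ _+_ρ (re x y) (im x y)
  where
  re : ∀ x y → x * (x + y) - y * - y ≡ x * x + x * y + y * y
  re = solve-∀
  im : ∀ x y → x * - y + y * (x + y) + y * - y ≡ + 0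
  im = solve-∀

unitsE-* : All (λ u → All (λ v → (u *ᴱ v) ∈ unitsE) unitsE) unitsE
unitsE-* = toWitness {a? = All.all? (λ u → All.all? (λ v → Any.any? ((u *ᴱ v) ≟ᴱ_) unitsE) unitsE) unitsE} _

unitsE-inverse : All (λ u → u *ᴱ conj u ≡ (+ 1) + (+ 0) ρ) unitsE
unitsE-inverse = toWitness {a? = All.all? (λ u → (u *ᴱ conj u) ≟ᴱ ((+ 1) + (+ 0) ρ)) unitsE} _

-- The differences of distinct units have norm 1, 3 or 4.
unitsE-differences : AllPairs (λ u v → N (u -ᴱ v) ∣ₛ + 36) unitsE
unitsE-differences = toWitness {a? = AllPairs.allPairs? (λ u v → N (u -ᴱ v) ∣ₛ? + 36) unitsE} _

unitsE-minus-1 : All (λ u → u ≡ (+ 1) + (+ 0) ρ ⊎ N (u -ᴱ ((+ 1) + (+ 0) ρ)) ∣ₛ + 36) unitsE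
unitsE-minus-1 = toWitness {a? = All.all? (λ u → (u ≟ᴱ ((+ 1) + (+ 0) ρ)) ⊎-dec (N (u -ᴱ ((+ 1) + (+ 0) ρ)) ∣ₛ? + 36)) unitsE} _

-- A root b of x² - x + 1 modulo n is the image of ρ under a ring homomorphism to ℤ/n.
module Evaluation (n : ℕ) (b k : ℤ) (root : b * b - b + + 1 ≡ k * + n) where

  φ : ℤρ → ℤ
  φ (x + y ρ) = x + b * y

  -- Only the relation ρ² = ρ - 1 is at stake: the two sides differ by `y * v` times b² - b + 1.
  φ-*ᴱ : ∀ β γ → φ (β *ᴱ γ) ≋ φ β * φ γ mod n
  φ-*ᴱ (x + y ρ) (u + v ρ) = by (- (y * v * k)) (begin
    x * u - y * v + b * (x * v + y * u + y * v) - (x + b * y) * (u + b * v)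
      ≡⟨ lemma b x y u v ⟩
    - (y * v * (b * b - b + + 1))
      ≡⟨ cong (λ z → - (y * v * z)) root ⟩
    - (y * v * (k * + n))
      ≡⟨ lemma′ (y * v) k (+ n) ⟩
    - (y * v * k) * + n ∎)
    where
    lemma : ∀ b x y u v → x * u - y * v + b * (x * v + y * u + y * v) - (x + b * y) * (u + b * v) ≡ - (y * v * (b * b - b + + 1))
    lemma = solve-∀
    lemma′ : ∀ z k n → - (z * (k * n)) ≡ - (z * k) * n
    lemma′ = solve-∀

  φ-minus : ∀ β γ → φ (β -ᴱ γ) ≡ φ β - φ γ
  φ-minus (x + y ρ) (u + v ρ) = lemma b x y u v
    where
    lemma : ∀ b x y u v → x + - u + b * (y + - v) ≡ x + b * y - (u + b * v)
    lemma = solve-∀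

  φ-integer : ∀ x → φ (x + (+ 0) ρ) ≡ x
  φ-integer x = lemma b x
    where
    lemma : ∀ b x → x + b * + 0 ≡ x
    lemma = solve-∀

  φ-norm : ∀ β → (φ β * φ (conj β)) ≋ N β mod n
  φ-norm β = ≋-trans (≋-sym (φ-*ᴱ β (conj β))) (≋-reflexive (trans (cong φ (*ᴱ-conj β)) (φ-integer (N β))))

  units-mod : List ℤ
  units-mod = map φ unitsE

  -- The images of the units as a Frobenius complement

  module FirstKind (j : ℤ) (n≡1 : + n - + 1 ≡ j * + 6) (n≥7 : 7 ℕ.≤ n) where

    -- Since 6j ≡ -1, also 36j² ≡ 1 modulo `n`. The number 36 is a common multiple of the norms 1,
    -- 3, 4 and the square of 6.
    36-regular : ∀ z → (+ 36 * z) ≋ + 0 mod n → z ≋ + 0 mod n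
    36-regular z (by q eq) = by (q * j * j + + 2 * z - + n * z) (begin
      z - + 0
        ≡⟨ lemma z (+ n) ⟩
      z * (+ n - + 1) * (+ n - + 1) + (+ 2 * z - + n * z) * + n
        ≡⟨ cong (λ m → z * m * m + (+ 2 * z - + n * z) * + n) n≡1 ⟩
      z * (j * + 6) * (j * + 6) + (+ 2 * z - + n * z) * + n
        ≡⟨ lemma′ z j (+ n) ⟩
      (+ 36 * z - + 0) * j * j + (+ 2 * z - + n * z) * + n
        ≡⟨ cong (λ m → m * j * j + (+ 2 * z - + n * z) * + n) eq ⟩
      q * + n * j * j + (+ 2 * z - + n * z) * + n
        ≡⟨ lemma″ q (+ n) j z ⟩
      (q * j * j + + 2 * z - + n * z) * + n ∎)
      where
      lemma : ∀ z n → z - + 0 ≡ z * (n - + 1) * (n - + 1) + (+ 2 * z - n * z) * n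
      lemma = solve-∀
      lemma′ : ∀ z j n → z * (j * + 6) * (j * + 6) + (+ 2 * z - n * z) * n ≡ (+ 36 * z - + 0) * j * j + (+ 2 * z - n * z) * n
      lemma′ = solve-∀
      lemma″ : ∀ q n j z → q * n * j * j + (+ 2 * z - n * z) * n ≡ (q * j * j + + 2 * z - n * z) * n
      lemma″ = solve-∀

    -- Modulo `n`, `φ β` divides the norm of `β` and hence 36, so whatever it kills is killed by 36.
    norm∣36-regular : ∀ β z → N β ∣ₛ + 36 → (φ β * z) ≋ + 0 mod n → z ≋ + 0 mod n
    norm∣36-regular β z (divides w 36≡wN) βz≋0 = 36-regular z
      (≋-trans (≋-reflexive (trans (cong (_* z) 36≡wN) (lemma w (N β) z)))
      (≋-trans (≋-*ʳ (w * z) (≋-sym (φ-norm β)))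
      (≋-trans (≋-reflexive (lemma′ (φ β) (φ (conj β)) w z))
      (≋-*ʳ (φ (conj β) * w) βz≋0))))
      where
      lemma : ∀ w N z → w * N * z ≡ N * (w * z)
      lemma = solve-∀
      lemma′ : ∀ p q w z → p * q * (w * z) ≡ p * z * (q * w)
      lemma′ = solve-∀

    1≄0 : ¬ (+ 1 ≋ + 0 mod n)
    1≄0 1≋0 with () ← ≋⇒≡ {n} (ℕ.≤-trans (s≤s (s≤s z≤n)) n≥7) (ℕ.≤-trans (s≤s z≤n) n≥7) 1≋0

    -- If two images agreed, their difference would kill 1, forcing 1 ≡ 0.
    units-mod-distinct : AllPairs (λ x y → ¬ Congr n x y) units-mod
    units-mod-distinct = AllPairs.map⁺ {f = φ} (AllPairs.map (λ {u} {v} → distinct u v) unitsE-differences)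
      where
      distinct : ∀ u v → N (u -ᴱ v) ∣ₛ + 36 → ¬ Congr n (φ u) (φ v)
      distinct u v N∣36 φu≋φv with Congr⇒≋ n (φ u) (φ v) φu≋φv
      ... | by q eq = 1≄0 (norm∣36-regular (u -ᴱ v) (+ 1) N∣36
        (by q (trans (trans (lemma (φ (u -ᴱ v))) (φ-minus u v)) eq)))
        where
        lemma : ∀ z → z * + 1 - + 0 ≡ z
        lemma = solve-∀

    -- A fixed `z` is killed by `h - 1`, the image of a unit minus 1; unless that unit is 1, the
    -- difference has norm dividing 36 and can be cancelled.
    units-mod-fixed-point : ∀ {h} → h ∈ units-mod → ∀ {z} →
      (h * z) ≋ z mod n → ¬ (z ≋ + 0 mod n) → h ≋ + 1 mod n
    units-mod-fixed-point {h} h∈ {z} (by q eq) z≄0 with ∈-map⁻ φ h∈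
    ... | u , u∈ , refl with All.lookup unitsE-minus-1 u∈
    ... | inj₁ refl = ≋-reflexive (φ-integer (+ 1))
    ... | inj₂ N∣36 = contradiction (norm∣36-regular (u -ᴱ ((+ 1) + (+ 0) ρ)) z N∣36 (by q (trans (begin
      φ (u -ᴱ ((+ 1) + (+ 0) ρ)) * z - + 0       ≡⟨ cong (λ w → w * z - + 0) (φ-minus u ((+ 1) + (+ 0) ρ)) ⟩
      (φ u - φ ((+ 1) + (+ 0) ρ)) * z - + 0 ≡⟨ cong (λ w → (φ u - w) * z - + 0) (φ-integer (+ 1)) ⟩
      (φ u - + 1) * z - + 0      ≡⟨ lemma (φ u) z ⟩
      φ u * z - z                ∎) eq))) z≄0
      where
      lemma : ∀ h z → (h - + 1) * z - + 0 ≡ h * z - z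
      lemma = solve-∀

    1∈ : φ ((+ 1) + (+ 0) ρ) ∈ units-mod
    1∈ = here refl

    -1∈ : φ ((- + 1) + (+ 0) ρ) ∈ units-mod
    -1∈ = there (here refl)

    isUnitSubgroup : IsUnitSubgroup n units-mod
    isUnitSubgroup = here (≋⇒Congr (≋-reflexive (φ-integer (+ 1)))) , product , inverse
      where
      product : ∀ {h h′} → h ∈ units-mod → h′ ∈ units-mod → Any (Congr n (h * h′)) units-mod
      product h∈ h′∈ with ∈-map⁻ φ h∈ | ∈-map⁻ φ h′∈
      ... | u , u∈ , refl | v , v∈ , refl =
        Any.map⁺ {f = φ} {P = Congr n (φ u * φ v)} (Any.map (λ { refl → ≋⇒Congr (≋-sym (φ-*ᴱ u v)) }) (All.lookup (All.lookup unitsE-* u∈) v∈))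
      inverse : ∀ {h} → h ∈ units-mod → ∃ λ u → Congr n (h * u) (+ 1)
      inverse h∈ with ∈-map⁻ φ h∈
      ... | u , u∈ , refl = φ (conj u) , ≋⇒Congr (≋-trans (≋-sym (φ-*ᴱ u (conj u)))
        (≋-reflexive (trans (cong φ (All.lookup unitsE-inverse u∈)) (φ-integer (+ 1)))))

    isFrobeniusAffine : IsFrobeniusAffine n units-mod
    isFrobeniusAffine = transitive , nonregular , λ h∈ → semiregular h∈
      where
      transitive : ∀ x y → Σ ℤ λ h → h ∈ units-mod × Σ ℤ λ t → Congr n (h * x + t) y
      transitive x y = φ ((+ 1) + (+ 0) ρ) , 1∈ , y - x , ≋⇒Congr (≋-reflexive (lemma b x y))
        where
        lemma : ∀ b x y → (+ 1 + b * + 0) * x + (y - x) ≡ y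
        lemma = solve-∀
      nonregular : Σ ℤ λ h → h ∈ units-mod × Σ ℤ λ t → Σ ℤ λ x →
        ¬ (Congr n h (+ 1) × Congr n t (+ 0)) × Congr n (h * x + t) x
      -- The map x ↦ -x fixes 0. It is not the identity because 1 and -1, the first two units, have
      -- distinct images.
      nonregular = φ ((- + 1) + (+ 0) ρ) , -1∈ , + 0 , + 0 ,
        (λ (-1≋1 , _) → All.head (AllPairs.head units-mod-distinct)
          (≋⇒Congr (≋-trans (≋-reflexive (φ-integer (+ 1))) (≋-sym (Congr⇒≋ n (φ ((- + 1) + (+ 0) ρ)) (+ 1) -1≋1))))) ,
        ≋⇒Congr (≋-reflexive (lemma b))
        where
        lemma : ∀ b → (- + 1 + b * + 0) * + 0 + + 0 ≡ + 0
        lemma = solve-∀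
      semiregular : ∀ {h} → h ∈ units-mod → ∀ t x y → ¬ Congr n x y →
        Congr n (h * x + t) x → Congr n (h * y + t) y → Congr n h (+ 1) × Congr n t (+ 0)
      semiregular {h} h∈ t x y x≄y fx fy
        with Congr⇒≋ n (h * x + t) x fx | Congr⇒≋ n (h * y + t) y fy
      ... | by p eq | by q eq′ = ≋⇒Congr h≋1 , ≋⇒Congr (t≋0 h≋1)
        where
        -- Subtracting the two fixed-point equations removes `t`, so `h` fixes the nonzero residue
        -- `x - y`.
        h≋1 : h ≋ + 1 mod n
        h≋1 = units-mod-fixed-point h∈ {x - y}
          (by (p - q) (begin
            h * (x - y) - (x - y)             ≡⟨ lemma h x y t ⟩
            (h * x + t - x) - (h * y + t - y) ≡⟨ cong₂ _-_ eq eq′ ⟩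
            p * + n - q * + n                 ≡⟨ lemma′ p q (+ n) ⟩
            (p - q) * + n                     ∎))
          (λ (by w eq″) → x≄y (≋⇒Congr {n} {x} {y} (by w (trans (sym (+-identityʳ (x - y))) eq″))))
          where
          lemma : ∀ h x y t → h * (x - y) - (x - y) ≡ (h * x + t - x) - (h * y + t - y)
          lemma = solve-∀
          lemma′ : ∀ p q n → p * n - q * n ≡ (p - q) * n
          lemma′ = solve-∀
        t≋0 : h ≋ + 1 mod n → t ≋ + 0 mod n
        t≋0 (by w eq″) = by (p - w * x) (begin
          t - + 0                            ≡⟨ lemma h x t ⟩
          (h * x + t - x) - (h - + 1) * x    ≡⟨ cong₂ (λ u v → u - v * x) eq eq″ ⟩
          p * + n - w * + n * x              ≡⟨ lemma′ p w x (+ n) ⟩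
          (p - w * x) * + n                  ∎)
          where
          lemma : ∀ h x t → t - + 0 ≡ (h * x + t - x) - (h - + 1) * x
          lemma = solve-∀
          lemma′ : ∀ p w x n → p * n - w * n * x ≡ (p - w * x) * n
          lemma′ = solve-∀

    orbit-1 : orbit units-mod (+ 1) ≡ units-mod
    orbit-1 = trans (map-cong *-identityʳ units-mod) (map-id units-mod)

    cardMod : CardMod n units-mod 6
    cardMod = units-mod , refl , units-mod-distinct , self , self
      where
      self : ∀ {x} → x ∈ units-mod → Any (Congr n x) units-mod
      self {x} = Any.map (λ { refl → ≋⇒Congr (≋-refl {n} {x}) })

    frobCirc6 : FrobCirc6
    frobCirc6 = record
      { n     = n
      ; n≥1   = ℕ.≤-trans (s≤s z≤n) n≥7
      ; H     = units-mod
      ; a     = + 1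
      ; H-grp = isUnitSubgroup
      ; frob  = isFrobeniusAffine
      -- The orbit starts with 1, which alone generates.
      ; gen   = λ x → x ∷ + 0 ∷ + 0 ∷ + 0 ∷ + 0 ∷ + 0 ∷ [] , refl , ≋⇒Congr (≋-reflexive (lemma b x))
      ; kind1 = inj₁ (3 , cardMod)
      ; val6  = subst (λ L → CardMod n L 6) (sym orbit-1) cardMod
      }
      where
      lemma : ∀ b x → x ≡ x * ((+ 1 + b * + 0) * + 1) + + 0
      lemma = solve-∀

  -- Identification of ℤ[ρ]/(α) with ℤ/n

  module Quotient (c d t : ℤ) (φ-α : φ (c + d ρ) ≡ t * + n) (norm : N (c + d ρ) ≡ + n) .{{_ : ℕ.NonZero n}} where

    α : ℤρ
    α = c + d ρ

    φ-cong : ∀ β γ → CongrE α β γ → φ β ≋ φ γ mod n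
    φ-cong β γ (q , eq) = vanish (≋-trans (φ-*ᴱ α q) (≋-*ʳ {x = φ α} {y = + 0} (φ q) (by t (trans (+-identityʳ (φ α)) φ-α))))
      where
      lemma : ∀ z y → z ≡ z - + 0 * y
      lemma = solve-∀
      vanish : φ (α *ᴱ q) ≋ + 0 * φ q mod n → φ β ≋ φ γ mod n
      vanish (by w eq′) = by w (begin
        φ β - φ γ                   ≡⟨ φ-minus β γ ⟨
        φ (β -ᴱ γ)                  ≡⟨ cong φ eq ⟩
        φ (α *ᴱ q)                  ≡⟨ lemma (φ (α *ᴱ q)) (φ q) ⟩
        φ (α *ᴱ q) - + 0 * φ q      ≡⟨ eq′ ⟩
        w * + n                     ∎)

    -- The quotient by α is conj α * β / n.
    φ-kernel : ∀ β p → φ β ≡ p * + n → ∃ λ q → β ≡ α *ᴱ q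
    φ-kernel (x + y ρ) p eq = u + v ρ , cong₂ _+_ρ (cancel re) (cancel im)
      where
      -- The coordinates of `conj α * β`, with `n` divided out after substituting x = pn - by, c =
      -- tn - bd and b² - b + 1 = kn.
      u = p * (c + d) + y * (d * k - b * t)
      v = t * y - p * d

      nu : + n * u ≡ x * (c + d) + y * d
      nu = begin
        + n * u
          ≡⟨ lemma (+ n) p c d y k b t ⟩
        p * + n * (c + d) + y * (d * (k * + n)) - y * (b * (t * + n))
          ≡⟨ cong₂ (λ v w → v + y * (d * (k * + n)) - y * (b * w)) (cong (_* (c + d)) eq) φ-α ⟨
        (x + b * y) * (c + d) + y * (d * (k * + n)) - y * (b * (c + b * d))
          ≡⟨ cong (λ z → (x + b * y) * (c + d) + y * (d * z) - y * (b * (c + b * d))) root ⟨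
        (x + b * y) * (c + d) + y * (d * (b * b - b + + 1)) - y * (b * (c + b * d))
          ≡⟨ lemma′ x b y c d ⟩
        x * (c + d) + y * d ∎
        where
        lemma : ∀ n p c d y k b t → n * (p * (c + d) + y * (d * k - b * t)) ≡ p * n * (c + d) + y * (d * (k * n)) - y * (b * (t * n))
        lemma = solve-∀
        lemma′ : ∀ x b y c d → (x + b * y) * (c + d) + y * (d * (b * b - b + + 1)) - y * (b * (c + b * d)) ≡ x * (c + d) + y * d
        lemma′ = solve-∀

      nv : + n * v ≡ y * c - x * d
      nv = begin
        + n * v                                  ≡⟨ lemma (+ n) t y p d ⟩
        t * + n * y - p * + n * d                ≡⟨ cong₂ (λ v w → v * y - w * d) φ-α eq ⟨
        (c + b * d) * y - (x + b * y) * d        ≡⟨ lemma′ c b d y x ⟩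
        y * c - x * d                            ∎
        where
        lemma : ∀ n t y p d → n * (t * y - p * d) ≡ t * n * y - p * n * d
        lemma = solve-∀
        lemma′ : ∀ c b d y x → (c + b * d) * y - (x + b * y) * d ≡ y * c - x * d
        lemma′ = solve-∀

      cancel : ∀ {i j} → + n * i ≡ + n * j → i ≡ j
      cancel {i} {j} = *-cancelˡ-≡ (+ n) i j

      -- `re` and `im` are the coordinates of `N α * β = α * (conj α * β)`.
      re : + n * x ≡ + n * (c * u - d * v)
      re = begin
        + n * x                                              ≡⟨ cong (_* x) norm ⟨
        (c * c + c * d + d * d) * x                          ≡⟨ lemma c d x y ⟩
        c * (x * (c + d) + y * d) - d * (y * c - x * d)      ≡⟨ cong₂ (λ v w → c * v - d * w) nu nv ⟨
        c * (+ n * u) - d * (+ n * v)                        ≡⟨ lemma′ c d (+ n) u v ⟩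
        + n * (c * u - d * v)                                ∎
        where
        lemma : ∀ c d x y → (c * c + c * d + d * d) * x ≡ c * (x * (c + d) + y * d) - d * (y * c - x * d)
        lemma = solve-∀
        lemma′ : ∀ c d n u v → c * (n * u) - d * (n * v) ≡ n * (c * u - d * v)
        lemma′ = solve-∀

      im : + n * y ≡ + n * (c * v + d * u + d * v)
      im = begin
        + n * y                        ≡⟨ cong (_* y) norm ⟨
        (c * c + c * d + d * d) * y    ≡⟨ lemma c d x y ⟩
        c * (y * c - x * d) + d * (x * (c + d) + y * d) + d * (y * c - x * d)
          ≡⟨ cong₂ (λ v w → c * w + d * v + d * w) nu nv ⟨
        c * (+ n * v) + d * (+ n * u) + d * (+ n * v) ≡⟨ lemma′ c d (+ n) u v ⟩
        + n * (c * v + d * u + d * v)  ∎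
        where
        lemma : ∀ c d x y → (c * c + c * d + d * d) * y ≡ c * (y * c - x * d) + d * (x * (c + d) + y * d) + d * (y * c - x * d)
        lemma = solve-∀
        lemma′ : ∀ c d n u v → c * (n * v) + d * (n * u) + d * (n * v) ≡ n * (c * v + d * u + d * v)
        lemma′ = solve-∀

    φ-inj : ∀ β γ → φ β ≋ φ γ mod n → CongrE α β γ
    φ-inj β γ (by p eq) = φ-kernel (β -ᴱ γ) p (trans (φ-minus β γ) eq)

    Adj⇒units-mod : ∀ β γ → Graph.Adj (EJ α) β γ → Any (Congr n (φ γ - φ β)) units-mod
    Adj⇒units-mod β γ adj = Any.map⁺ {f = φ} {P = Congr n (φ γ - φ β)}
      (Any.map (λ {u} e → ≋⇒Congr {n} {φ γ - φ β} {φ u}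
        (≋-trans (≋-reflexive (sym (φ-minus γ β))) (φ-cong (γ -ᴱ β) u e))) adj)

    units-mod⇒Adj : ∀ β γ → Any (Congr n (φ γ - φ β)) units-mod → Graph.Adj (EJ α) β γ
    units-mod⇒Adj β γ adj =
      Any.map (λ {u} e → φ-inj (γ -ᴱ β) u
        (≋-trans (≋-reflexive (φ-minus γ β)) (Congr⇒≋ n (φ γ - φ β) (φ u) e)))
        (Any.map⁻ {f = φ} {P = Congr n (φ γ - φ β)} adj)

    EJ≅Circulant : EJ α ≅ Circulant n units-mod
    EJ≅Circulant = record
      { f      = φ
      ; f-cong = λ {β} {γ} e → ≋⇒Congr {n} {φ β} {φ γ} (φ-cong β γ e)
      ; f-inj  = λ {β} {γ} e → φ-inj β γ (Congr⇒≋ n (φ β) (φ γ) e)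
      ; f-surj = λ y → y + (+ 0) ρ , ≋⇒Congr (≋-reflexive (φ-integer y))
      ; f-adj  = Adj⇒units-mod
      ; f-adj⁻ = units-mod⇒Adj
      }

    -- Inverse to `φ` on classes: every class modulo `α` contains an integer.
    ι : ℤ → ℤρ
    ι x = x + (+ 0) ρ

    ι-cong : ∀ x y → x ≋ y mod n → CongrE α (ι x) (ι y)
    ι-cong x y x≋y = φ-inj (ι x) (ι y) (subst₂ (λ u v → u ≋ v mod n) (sym (φ-integer x)) (sym (φ-integer y)) x≋y)

    ι-inj : ∀ x y → CongrE α (ι x) (ι y) → x ≋ y mod n
    ι-inj x y e = subst₂ (λ u v → u ≋ v mod n) (φ-integer x) (φ-integer y) (φ-cong (ι x) (ι y) e)

    ι-φ : ∀ β → CongrE α (ι (φ β)) β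
    ι-φ β = φ-inj (ι (φ β)) β (≋-reflexive (φ-integer (φ β)))

    -- Mutual inclusion allows for `TL`, which lists the six residues in another order.
    Circulant≅EJ : ∀ S → S ⊆ units-mod → units-mod ⊆ S → Circulant n S ≅ EJ α
    Circulant≅EJ S S⊆ ⊆S = record
      { f      = ι
      ; f-cong = λ {x} {y} e → ι-cong x y (Congr⇒≋ n x y e)
      ; f-inj  = λ {x} {y} e → ≋⇒Congr {n} {x} {y} (ι-inj x y e)
      ; f-surj = λ β → φ β , ι-φ β
      ; f-adj  = λ x y adj → units-mod⇒Adj (ι x) (ι y)
          (subst (λ z → Any (Congr n z) units-mod) (sym (difference x y)) (Any-resp-⊆ S⊆ adj))
      ; f-adj⁻ = λ x y adj → Any-resp-⊆ ⊆S
          (subst (λ z → Any (Congr n z) units-mod) (difference x y) (Adj⇒units-mod (ι x) (ι y) adj))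
      }
      where
      difference : ∀ x y → φ (ι y) - φ (ι x) ≡ y - x
      difference x y = cong₂ _-_ (φ-integer y) (φ-integer x)

-- Frobenius circulants of valency 6 have order prime to 3

module _ (F : FrobCirc6) where
  open FrobCirc6 F renaming (n to m)

  instance
    m-nonZero : ℕ.NonZero m
    m-nonZero = ℕ.>-nonZero n≥1

  -- Otherwise h would fix both 0 and m / 3.
  ≋1-mod-3⇒≋1 : 3 ℕ.∣ m → ∀ {h} → h ∈ H → h ≋ + 1 mod 3 → h ≋ + 1 mod m
  ≋1-mod-3⇒≋1 (ℕ.divides l m≡l*3) {h} h∈ (by q eq) =
    Congr⇒≋ m h (+ 1) (proj₁ (proj₂ (proj₂ frob) h∈ (+ 0) (+ l) (+ 0) l≄0
      (≋⇒Congr {m} {h * + l + + 0} {+ l} (by q (begin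
        h * + l + + 0 - + l    ≡⟨ lemma h (+ l) ⟩
        (h - + 1) * + l        ≡⟨ cong (_* + l) eq ⟩
        q * + 3 * + l          ≡⟨ lemma′ q (+ l) ⟩
        q * (+ l * + 3)        ≡⟨ cong (q *_) (trans (cong +_ m≡l*3) (pos-* l 3)) ⟨
        q * + m                ∎)))
      (≋⇒Congr {m} {h * + 0 + + 0} {+ 0} (≋-reflexive (lemma″ h)))))
    where
    lemma : ∀ h l → h * l + + 0 - l ≡ (h - + 1) * l
    lemma = solve-∀
    lemma′ : ∀ q l → q * + 3 * l ≡ q * (l * + 3)
    lemma′ = solve-∀
    lemma″ : ∀ h → h * + 0 + + 0 ≡ + 0
    lemma″ = solve-∀
    l>0 : 0 ℕ.< l
    l>0 = ℕ.n≢0⇒n>0 (λ l≡0 → ℕ.n>0⇒n≢0 n≥1 (trans m≡l*3 (cong (ℕ._* 3) l≡0)))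
    l<m : l ℕ.< m
    l<m = subst (l ℕ.<_) (sym m≡l*3) (ℕ.m<m*n l 3 {{ℕ.>-nonZero l>0}} (s≤s (s≤s z≤n)))
    l≄0 : ¬ Congr m (+ l) (+ 0)
    l≄0 l≋0 = ℕ.n>0⇒n≢0 l>0 (≋⇒≡ l<m n≥1 (Congr⇒≋ m (+ l) (+ 0) l≋0))

  -- A unit modulo `m` stays a unit modulo 3, which excludes the residue 0.
  residue-mod-3 : 3 ℕ.∣ m → ∀ {h} → h ∈ H → h ≋ + 1 mod 3 ⊎ h ≋ + 2 mod 3
  residue-mod-3 3∣m {h} h∈ with h %ℕ 3 | %ℕ-≋ 3 h | n%ℕd<d h 3
  ... | 1 | h≋ | _ = inj₁ h≋
  ... | 2 | h≋ | _ = inj₂ h≋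
  ... | suc (suc (suc _)) | _ | s≤s (s≤s (s≤s ()))
  ... | 0 | h≋ | _ with proj₂ (proj₂ H-grp) h∈
  ... | u , hu≋1 with () ← ≋⇒≡ {3} {0} {1} (s≤s z≤n) (s≤s (s≤s z≤n))
    (≋-trans (≋-sym (≋-*ʳ u h≋)) (≋-mono-∣ 3∣m (Congr⇒≋ m (h * u) (+ 1) hu≋1)))

  -- The product is 4 ≡ 1 modulo 3. Since `H` contains it only up to congruence, `go` finds its
  -- representative `g`, to which `≋1-mod-3⇒≋1` applies.
  product-≋1 : 3 ℕ.∣ m → ∀ {h h′} → h ∈ H → h′ ∈ H →
    h ≋ + 2 mod 3 → h′ ≋ + 2 mod 3 → h * h′ ≋ + 1 mod m
  product-≋1 3∣m {h} {h′} h∈ h′∈ h≋2 h′≋2 = go (proj₁ (proj₂ H-grp) h∈ h′∈) λ g∈ → g∈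
    where
    go : ∀ {L} → Any (Congr m (h * h′)) L → L ⊆ H → h * h′ ≋ + 1 mod m
    go {g ∷ _} (here e) L⊆H = ≋-trans hh′≋g (≋1-mod-3⇒≋1 3∣m (L⊆H (here refl))
      (≋-trans (≋-sym (≋-mono-∣ 3∣m hh′≋g))
      (≋-trans (≋-*ʳ h′ h≋2) (≋-trans (≋-*ˡ (+ 2) h′≋2) (by (+ 1) refl)))))
      where
      hh′≋g : h * h′ ≋ g mod m
      hh′≋g = Congr⇒≋ m (h * h′) g e
    go (there any) L⊆H = go any (L⊆H ∘ there)

  -- Bracket h·h·h′ in two ways: both h·h′ and h·h are 1 modulo `m`.
  ≋-mod-3⇒≋ : 3 ℕ.∣ m → ∀ {h h′} → h ∈ H → h′ ∈ H →
    h ≋ + 2 mod 3 → h′ ≋ + 2 mod 3 → h ≋ h′ mod m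
  ≋-mod-3⇒≋ 3∣m {h} {h′} h∈ h′∈ h≋2 h′≋2 =
    ≋-trans (≋-reflexive (lemma h))
    (≋-trans (≋-*ˡ h (≋-sym (product-≋1 3∣m h∈ h′∈ h≋2 h′≋2)))
    (≋-trans (≋-reflexive (sym (*-assoc h h h′)))
    (≋-trans (≋-*ʳ h′ (product-≋1 3∣m h∈ h∈ h≋2 h≋2)) (≋-reflexive (*-identityˡ h′)))))
    where
    lemma : ∀ h → h ≡ h * + 1
    lemma = solve-∀

  orbit⇒H : ∀ {r} → Any (Congr m r) (orbit H a) → ∃ λ h → h ∈ H × r ≋ h * a mod m
  orbit⇒H {r} any = go (Any.map⁻ {f = _* a} {P = Congr m r} any) λ h∈ → h∈
    where
    go : ∀ {L} → Any (λ h → Congr m r (h * a)) L → L ⊆ H → ∃ λ h → h ∈ H × r ≋ h * a mod m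
    go {h ∷ _} (here e)    L⊆H = h , L⊆H (here refl) , Congr⇒≋ m r (h * a) e
    go         (there any) L⊆H = go any (L⊆H ∘ there)

  -- An element of `H` would be determined modulo `m` by its residue 1 or 2 modulo 3, so three
  -- distinct orbit elements already contradict the pigeonhole principle.
  order-coprime-3 : ¬ 3 ℕ.∣ m
  order-coprime-3 3∣m with val6
  ... | r₁ ∷ r₂ ∷ r₃ ∷ _ , _ , (r₁≄r₂ All.∷ r₁≄r₃ All.∷ _) ∷ (r₂≄r₃ All.∷ _) ∷ _ , _ , orb
    with orbit⇒H (orb (here refl)) | orbit⇒H (orb (there (here refl))) | orbit⇒H (orb (there (there (here refl))))
  ... | h₁ , h₁∈ , r₁≋ | h₂ , h₂∈ , r₂≋ | h₃ , h₃∈ , r₃≋ =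
    pigeonhole (residue-mod-3 3∣m h₁∈) (residue-mod-3 3∣m h₂∈) (residue-mod-3 3∣m h₃∈)
    where
    distinct : ∀ r r′ {h h′} → ¬ Congr m r r′ → r ≋ h * a mod m → r′ ≋ h′ * a mod m → ¬ h ≋ h′ mod m
    distinct r r′ r≄r′ r≋ r′≋ h≋h′ = r≄r′ (≋⇒Congr {m} {r} {r′} (≋-trans r≋ (≋-trans (≋-*ʳ a h≋h′) (≋-sym r′≋))))
    both-1 : ∀ {h h′} → h ∈ H → h′ ∈ H → h ≋ + 1 mod 3 → h′ ≋ + 1 mod 3 → h ≋ h′ mod m
    both-1 h∈ h′∈ e e′ = ≋-trans (≋1-mod-3⇒≋1 3∣m h∈ e) (≋-sym (≋1-mod-3⇒≋1 3∣m h′∈ e′))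
    h₁≄h₂ = distinct r₁ r₂ r₁≄r₂ r₁≋ r₂≋
    h₁≄h₃ = distinct r₁ r₃ r₁≄r₃ r₁≋ r₃≋
    h₂≄h₃ = distinct r₂ r₃ r₂≄r₃ r₂≋ r₃≋
    pigeonhole : h₁ ≋ + 1 mod 3 ⊎ h₁ ≋ + 2 mod 3 → h₂ ≋ + 1 mod 3 ⊎ h₂ ≋ + 2 mod 3 →
      h₃ ≋ + 1 mod 3 ⊎ h₃ ≋ + 2 mod 3 → ⊥
    pigeonhole (inj₁ p) (inj₁ q) _        = h₁≄h₂ (both-1 h₁∈ h₂∈ p q)
    pigeonhole (inj₂ p) (inj₂ q) _        = h₁≄h₂ (≋-mod-3⇒≋ 3∣m h₁∈ h₂∈ p q)
    pigeonhole (inj₁ p) _        (inj₁ r) = h₁≄h₃ (both-1 h₁∈ h₃∈ p r)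
    pigeonhole (inj₂ p) _        (inj₂ r) = h₁≄h₃ (≋-mod-3⇒≋ 3∣m h₁∈ h₃∈ p r)
    pigeonhole _        (inj₁ q) (inj₁ r) = h₂≄h₃ (both-1 h₂∈ h₃∈ q r)
    pigeonhole _        (inj₂ q) (inj₂ r) = h₂≄h₃ (≋-mod-3⇒≋ 3∣m h₂∈ h₃∈ q r)

-- The norm form modulo 6

N-cong : ∀ {n x y u v} → x ≋ u mod n → y ≋ v mod n → N (x + y ρ) ≋ N (u + v ρ) mod n
N-cong {n} {x} {y} {u} {v} (by p eq) (by q eq′) = by (p * (x + u + y) + q * (u + y + v)) (begin
  x * x + x * y + y * y - (u * u + u * v + v * v)       ≡⟨ lemma x y u v ⟩
  (x - u) * (x + u + y) + (y - v) * (u + y + v)         ≡⟨ cong₂ (λ i j → i * (x + u + y) + j * (u + y + v)) eq eq′ ⟩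
  p * + n * (x + u + y) + q * + n * (u + y + v)         ≡⟨ lemma′ p (+ n) (x + u + y) q (u + y + v) ⟩
  (p * (x + u + y) + q * (u + y + v)) * + n             ∎)
  where
  lemma : ∀ x y u v → x * x + x * y + y * y - (u * u + u * v + v * v) ≡ (x - u) * (x + u + y) + (y - v) * (u + y + v)
  lemma = solve-∀
  lemma′ : ∀ p n i q j → p * n * i + q * n * j ≡ (p * i + q * j) * n
  lemma′ = solve-∀

∣⇒≋0 : ∀ {n x} → + n ∣ₛ x → x ≋ + 0 mod n
∣⇒≋0 {x = x} (divides q eq) = by q (trans (+-identityʳ x) eq)

≋0⇒∣ : ∀ {n x} → x ≋ + 0 mod n → n ℕ.∣ ∣ x ∣
≋0⇒∣ {n} {x} (by q eq) = ∣⇒∣ᵤ {+ n} {x} (divides q (trans (sym (+-identityʳ x)) eq))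

-- Decided by evaluating all 36 pairs: the norm is even only if both coordinates are, and modulo 3
-- it is 0 or 1.
N-mod-6-table : ∀ (i j : Fin 6) → (+ 2 ∣ₛ + toℕ i × + 2 ∣ₛ + toℕ j)
  ⊎ + 3 ∣ₛ N ((+ toℕ i) + (+ toℕ j) ρ) ⊎ + 6 ∣ₛ N ((+ toℕ i) + (+ toℕ j) ρ) - + 1
N-mod-6-table = toWitness {a? = Fin.all? λ i → Fin.all? λ j →
  (+ 2 ∣ₛ? + toℕ i ×-dec + 2 ∣ₛ? + toℕ j)
  ⊎-dec (+ 3 ∣ₛ? N ((+ toℕ i) + (+ toℕ j) ρ) ⊎-dec + 6 ∣ₛ? N ((+ toℕ i) + (+ toℕ j) ρ) - + 1)} _

residue : ∀ n x .{{_ : ℕ.NonZero n}} → ∃ λ (i : Fin n) → x ≋ + toℕ i mod n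
residue n x = fromℕ< (n%ℕd<d x n) , subst (λ r → x ≋ + r mod n) (sym (Fin.toℕ-fromℕ< (n%ℕd<d x n))) (%ℕ-≋ n x)

-- Of the three alternatives in the table, coprimality rules out the first and indivisibility by 3
-- the second.
N≋1-mod-6 : ∀ c d → gcd c d ≡ + 1 → ¬ 3 ℕ.∣ ∣ N (c + d ρ) ∣ → N (c + d ρ) ≋ + 1 mod 6
N≋1-mod-6 c d gcd≡1 3∤N = conclude (residue 6 c) (residue 6 d)
  where
  even : ∀ {x y} → x ≋ y mod 6 → + 2 ∣ₛ y → 2 ℕ.∣ ∣ x ∣
  even x≋y 2∣y = ≋0⇒∣ (≋-trans (≋-mono-∣ (ℕ.divides 3 refl) x≋y) (∣⇒≋0 2∣y))

  by-cases : ∀ x y → c ≋ x mod 6 → d ≋ y mod 6 →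
    (+ 2 ∣ₛ x × + 2 ∣ₛ y) ⊎ + 3 ∣ₛ N (x + y ρ) ⊎ + 6 ∣ₛ N (x + y ρ) - + 1 →
    N (c + d ρ) ≋ + 1 mod 6
  by-cases x y c≋x d≋y (inj₁ (2∣x , 2∣y)) = contradiction (ℕ.∣1⇒≡1 2∣1) λ ()
    where
    2∣1 : 2 ℕ.∣ 1
    2∣1 = subst (2 ℕ.∣_) (+-injective gcd≡1)
      (ℕ.gcd-greatest {∣ c ∣} {∣ d ∣} (even c≋x 2∣x) (even d≋y 2∣y))
  by-cases x y c≋x d≋y (inj₂ (inj₁ 3∣N)) = contradiction
    (≋0⇒∣ (≋-trans (≋-mono-∣ (ℕ.divides 2 refl) (N-cong c≋x d≋y)) (∣⇒≋0 3∣N))) 3∤N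
  by-cases x y c≋x d≋y (inj₂ (inj₂ (divides q eq))) = ≋-trans (N-cong c≋x d≋y) (by q eq)

  conclude : (∃ λ (i : Fin 6) → c ≋ + toℕ i mod 6) → (∃ λ (j : Fin 6) → d ≋ + toℕ j mod 6) →
    N (c + d ρ) ≋ + 1 mod 6
  conclude (i , c≋i) (j , d≋j) = by-cases (+ toℕ i) (+ toℕ j) c≋i d≋j (N-mod-6-table i j)

-- From a solution of the quadratic form to an Eisenstein-Jacobi graph

module NormFormSolution (n : ℕ) .{{_ : ℕ.NonZero n}} (a k : ℤ) (root : a * a - a + + 1 ≡ k * + n)
  (m s : ℤ) (form : k * m * m - (+ 2 * a - + 1) * s * m + s * s * + n ≡ + 1) where

  b d : ℤ
  b = + 1 - a
  d = s * + n - m * a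

  root′ : b * b - b + + 1 ≡ k * + n
  root′ = trans (lemma a) root
    where
    lemma : ∀ a → (+ 1 - a) * (+ 1 - a) - (+ 1 - a) + + 1 ≡ a * a - a + + 1
    lemma = solve-∀

  open Evaluation n b k root′

  -- Once a² - a + 1 is replaced by kn, the norm is `n` times the form, which has value 1.
  norm : N (m + d ρ) ≡ + n
  norm = begin
    m * m + m * d + d * d
      ≡⟨ lemma m s (+ n) a ⟩
    m * m * (a * a - a + + 1) + (s * s * + n - (+ 2 * a - + 1) * s * m) * + n
      ≡⟨ cong (λ z → m * m * z + (s * s * + n - (+ 2 * a - + 1) * s * m) * + n) root ⟩
    m * m * (k * + n) + (s * s * + n - (+ 2 * a - + 1) * s * m) * + n
      ≡⟨ lemma′ m s (+ n) a k ⟩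
    (k * m * m - (+ 2 * a - + 1) * s * m + s * s * + n) * + n
      ≡⟨ cong (_* + n) form ⟩
    + 1 * + n
      ≡⟨ *-identityˡ (+ n) ⟩
    + n ∎
    where
    lemma : ∀ m s n a → m * m + m * (s * n - m * a) + (s * n - m * a) * (s * n - m * a)
      ≡ m * m * (a * a - a + + 1) + (s * s * n - (+ 2 * a - + 1) * s * m) * n
    lemma = solve-∀
    lemma′ : ∀ m s n a k → m * m * (k * n) + (s * s * n - (+ 2 * a - + 1) * s * m) * n
      ≡ (k * m * m - (+ 2 * a - + 1) * s * m + s * s * n) * n
    lemma′ = solve-∀

  -- Modulo `n`, `d` is -ma, so the left side becomes m(a² - a + 1).
  φ-α : m + b * d ≡ (m * k + s * b) * + n
  φ-α = begin
    m + b * d                              ≡⟨ lemma m a s (+ n) ⟩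
    m * (a * a - a + + 1) + s * b * + n    ≡⟨ cong (λ z → m * z + s * b * + n) root ⟩
    m * (k * + n) + s * b * + n            ≡⟨ lemma′ m k (+ n) (s * b) ⟩
    (m * k + s * b) * + n                  ∎
    where
    lemma : ∀ m a s n → m + (+ 1 - a) * (s * n - m * a) ≡ m * (a * a - a + + 1) + s * (+ 1 - a) * n
    lemma = solve-∀
    lemma′ : ∀ m k n z → m * (k * n) + z * n ≡ (m * k + z) * n
    lemma′ = solve-∀

  -- Since s²n = sd + sam, `form` expresses 1 as a combination of `m` and `d`.
  coprime : gcd m d ≡ + 1
  coprime = cong +_ (ℕ.∣1⇒≡1 (∣⇒∣ᵤ {gcd m d} {+ 1} g∣1))
    where
    g∣m : gcd m d ∣ₛ m
    g∣m = ∣ᵤ⇒∣ (gcd[i,j]∣i m d)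
    g∣d : gcd m d ∣ₛ d
    g∣d = ∣ᵤ⇒∣ (gcd[i,j]∣j m d)
    lemma : ∀ k m a s n → k * m * m - (+ 2 * a - + 1) * s * m + s * s * n
      ≡ (k * m - (+ 2 * a - + 1) * s + s * a) * m + s * (s * n - m * a)
    lemma = solve-∀
    g∣1 : gcd m d ∣ₛ + 1
    g∣1 = subst (gcd m d ∣ₛ_) (trans (sym (lemma k m a s (+ n))) form)
      (Signed.∣m∣n⇒∣m+n (Signed.∣n⇒∣m*n (k * m - (+ 2 * a - + 1) * s + s * a) g∣m) (Signed.∣n⇒∣m*n s g∣d))

  S : List ℤ
  S = a ∷ - a ∷ (a - + 1) ∷ - (a - + 1) ∷ + 1 ∷ - + 1 ∷ []

  is-a : + 1 + b * - + 1 ≡ a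
  is-a = lemma a
    where
    lemma : ∀ a → + 1 + (+ 1 - a) * - + 1 ≡ a
    lemma = solve-∀
  is--a : - + 1 + b * + 1 ≡ - a
  is--a = lemma a
    where
    lemma : ∀ a → - + 1 + (+ 1 - a) * + 1 ≡ - a
    lemma = solve-∀
  is-a-1 : + 0 + b * - + 1 ≡ a - + 1
  is-a-1 = lemma a
    where
    lemma : ∀ a → + 0 + (+ 1 - a) * - + 1 ≡ a - + 1
    lemma = solve-∀
  is-1-a : + 0 + b * + 1 ≡ - (a - + 1)
  is-1-a = lemma a
    where
    lemma : ∀ a → + 0 + (+ 1 - a) * + 1 ≡ - (a - + 1)
    lemma = solve-∀

  -- In the order of `unitsE`, the images under ρ ↦ 1 - a are 1, -1, 1 - a, a - 1, -a, a.
  ⊆S : units-mod ⊆ S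
  ⊆S = All.lookup {P = _∈ S}
    ( there (there (there (there (here (φ-integer (+ 1))))))
    All.∷ there (there (there (there (there (here (φ-integer (- + 1)))))))
    All.∷ there (there (there (here is-1-a)))
    All.∷ there (there (here is-a-1))
    All.∷ there (here is--a)
    All.∷ here is-a
    All.∷ All.[])

  S⊆ : S ⊆ units-mod
  S⊆ = All.lookup {P = _∈ units-mod}
    ( there (there (there (there (there (here (sym is-a))))))
    All.∷ there (there (there (there (here (sym is--a)))))
    All.∷ there (there (there (here (sym is-a-1))))
    All.∷ there (there (here (sym is-1-a)))
    All.∷ here (sym (φ-integer (+ 1)))
    All.∷ there (here (sym (φ-integer (- + 1))))
    All.∷ All.[])

  TL≅EJ : TL n a (a - + 1) (+ 1) ≅ EJ (m + d ρ)
  TL≅EJ = Quotient.Circulant≅EJ m d (m * k + s * b) φ-α norm S S⊆ ⊆S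

abstract
  -- Being `abstract`, it keeps the recursively computed solution from unfolding. The form with
  -- leading coefficient `n` is solved at `s`, `m` in this order.
  TL-isEJ : ∀ (n : ℕ) .{{_ : ℕ.NonZero n}} (a k : ℤ) → a * a - a + + 1 ≡ k * + n →
    ∃₂ λ m s → gcd m (s * + n - m * a) ≡ + 1
      × N (m + (s * + n - m * a) ρ) ≡ + n
      × TL n a (a - + 1) (+ 1) ≅ EJ (m + (s * + n - m * a) ρ)
      × k * m * m - (+ 2 * a - + 1) * s * m + s * s * + n ≡ + 1
  TL-isEJ n a k root =
    let s , m , eq = represents-one n (<-wellFounded n) a k root
        form = trans (lemma k m a s (+ n)) eq
        open NormFormSolution n a k root m s form
    in m , s , coprime , norm , TL≅EJ , form
    where
    lemma : ∀ k m a s n → k * m * m - (+ 2 * a - + 1) * s * m + s * s * n ≡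
      n * s * s - (+ 2 * a - + 1) * s * m + k * m * m
    lemma = solve-∀

-- Primitive α and its root modulo the norm

module Primitive (c d : ℤ) (N≥7 : + 7 ≤ N (c + d ρ)) (coprime : gcd c d ≡ + 1) where

  n : ℕ
  n = ∣ N (c + d ρ) ∣

  norm : N (c + d ρ) ≡ + n
  norm = sym (0≤i⇒+∣i∣≡i (≤-trans (+≤+ z≤n) N≥7))

  n≥7 : 7 ℕ.≤ n
  n≥7 = drop‿+≤+ (subst (+ 7 ≤_) norm N≥7)

  instance
    n-nonZero : ℕ.NonZero n
    n-nonZero = ℕ.>-nonZero (ℕ.≤-trans (s≤s z≤n) n≥7)

  u = proj₁ (bézout c d coprime)
  v = proj₁ (proj₂ (bézout c d coprime))
  w≡1 : u * c + v * d ≡ + 1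
  w≡1 = proj₂ (proj₂ (bézout c d coprime))

  -- conj α * (- v + u ρ) = e + (u c + v d) ρ = e + ρ, so ρ ≡ e + 1 modulo α.
  e b k : ℤ
  e = d * u - c * v - d * v
  b = e + + 1
  k = N ((- v) + u ρ)

  -- The left side is e² + e + 1 = N(e + ρ), and the norm is multiplicative. Writing 1 as uc + vd
  -- makes the identity homogeneous in `c`, `d`.
  root : b * b - b + + 1 ≡ k * + n
  root = begin
    b * b - b + + 1                     ≡⟨ lemma e ⟩
    e * e + e * + 1 + + 1 * + 1         ≡⟨ cong (λ w → e * e + e * w + w * w) w≡1 ⟨
    e * e + e * (u * c + v * d) + (u * c + v * d) * (u * c + v * d)
                                        ≡⟨ lemma′ c d u v ⟩
    k * (c * c + c * d + d * d)         ≡⟨ cong (k *_) norm ⟩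
    k * + n                             ∎
    where
    lemma : ∀ e → (e + + 1) * (e + + 1) - (e + + 1) + + 1 ≡ e * e + e * + 1 + + 1 * + 1
    lemma = solve-∀
    lemma′ : ∀ c d u v → (d * u - c * v - d * v) * (d * u - c * v - d * v) + (d * u - c * v - d * v) * (u * c + v * d)
      + (u * c + v * d) * (u * c + v * d) ≡ (- v * - v + - v * u + u * u) * (c * c + c * d + d * d)
    lemma′ = solve-∀

  φ-α : c + b * d ≡ u * + n
  φ-α = begin
    c + b * d                      ≡⟨ lemma c d e ⟩
    c * + 1 + d * + 1 + d * e      ≡⟨ cong (λ w → c * w + d * w + d * e) w≡1 ⟨
    c * (u * c + v * d) + d * (u * c + v * d) + d * e
                                   ≡⟨ lemma′ c d u v ⟩
    u * (c * c + c * d + d * d)    ≡⟨ cong (u *_) norm ⟩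
    u * + n                        ∎
    where
    lemma : ∀ c d e → c + (e + + 1) * d ≡ c * + 1 + d * + 1 + d * e
    lemma = solve-∀
    lemma′ : ∀ c d u v → c * (u * c + v * d) + d * (u * c + v * d) + d * (d * u - c * v - d * v) ≡ u * (c * c + c * d + d * d)
    lemma′ = solve-∀

  open Evaluation n b k root
  open Quotient c d u φ-α norm

  -- Residues inject both ways: forwards by `f ∘ ι`, backwards by choosing a preimage under `f` and
  -- applying `φ`.
  order : (F : FrobCirc6) → EJ α ≅ FrobGraph F → n ≡ FrobCirc6.n F
  order F iso = ℕ.≤-antisym
    (residue-injection⇒≤ {m} {n} (f ∘ ι) (λ x y e → ι-inj x y (f-inj (≋⇒Congr e))))
    (residue-injection⇒≤ {n} {m} (λ y → φ (proj₁ (f-surj y))) λ x y e →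
      ≋-trans (≋-sym (Congr⇒≋ m (f (proj₁ (f-surj x))) x (proj₂ (f-surj x))))
      (≋-trans (Congr⇒≋ m _ _ (f-cong (φ-inj (proj₁ (f-surj x)) (proj₁ (f-surj y)) e)))
      (Congr⇒≋ m (f (proj₁ (f-surj y))) y (proj₂ (f-surj y)))))
    where
    open _≅_ iso
    m = FrobCirc6.n F
    instance
      m≢0 : ℕ.NonZero m
      m≢0 = m-nonZero F

  isFrobCirc6⇔ : IsFrobCirc6 (EJ α) ⇔ Congr 6 (N α) (+ 1)
  isFrobCirc6⇔ = mk⇔ to from
    where
    to : IsFrobCirc6 (EJ α) → Congr 6 (N α) (+ 1)
    to (F , iso) = ≋⇒Congr (N≋1-mod-6 c d coprime
      (λ 3∣n → order-coprime-3 F (subst (3 ℕ.∣_) (order F iso) 3∣n)))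
    from : Congr 6 (N α) (+ 1) → IsFrobCirc6 (EJ α)
    from N≋1 with Congr⇒≋ 6 (N α) (+ 1) N≋1
    ... | by j eq = FirstKind.frobCirc6 j n≡1 n≥7 ,
      subst (λ S → EJ α ≅ Circulant n S) (sym (FirstKind.orbit-1 j n≡1 n≥7)) EJ≅Circulant
      where
      n≡1 : + n - + 1 ≡ j * + 6
      n≡1 = trans (cong (_- + 1) (sym norm)) eq

theorem3p2 :
  -- (a)
  (∀ (n : ℕ) (a k : ℤ) → 7 ℕ.≤ n →
     a * a - a + + 1 ≡ k * + n →
     TLWellDefined n a (a - + 1) (+ 1) →
     IsFrobCirc6 (TL n a (a - + 1) (+ 1)) →
     Σ ℤ λ c → Σ ℤ λ d →
       gcd c d ≡ + 1 × + 7 ≤ N (c + d ρ)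
       × TL n a (a - + 1) (+ 1) ≅ EJ (c + d ρ)
       × Σ ℤ λ m → Σ ℤ λ r → Σ ℤ λ s →
           (c + d ρ ≡ (r * + n + m) + (s * + n - m * a) ρ
             × k * m * m - ((a - + 2) * r + (+ 2 * a - + 1) * s) * m
                 + (r * r + r * s + s * s) * + n ≡ + 1)
         ⊎ (c + d ρ ≡ (r * + n + m) + (s * + n + m * (a - + 1)) ρ
             × k * m * m + ((a + + 1) * r + (+ 2 * a - + 1) * s) * m
                 + (r * r + r * s + s * s) * + n ≡ + 1)
         ⊎ (c + d ρ ≡ (r * + n + m * a) + (s * + n - m * (a - + 1)) ρ
             × k * m * m + ((a + + 1) * r - (a - + 2) * s) * m
                 + (r * r + r * s + s * s) * + n ≡ + 1))
  ×
  -- (b)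
  (∀ (c d : ℤ) → + 7 ≤ N (c + d ρ) → gcd c d ≡ + 1 →
     IsFrobCirc6 (EJ (c + d ρ)) ⇔ Congr 6 (N (c + d ρ)) (+ 1))
theorem3p2 = (λ n a k n≥7 root _ _ → first-shape n a k n≥7 (TL-isEJ n {{ℕ.>-nonZero (ℕ.≤-trans (s≤s z≤n) n≥7)}} a k root)) ,
  Primitive.isFrobCirc6⇔
  where
  -- The first of the three equations, specialised to `r = 0`.
  lemma : ∀ k m a s n → k * m * m - ((a - + 2) * + 0 + (+ 2 * a - + 1) * s) * m
    + (+ 0 * + 0 + + 0 * s + s * s) * n ≡ k * m * m - (+ 2 * a - + 1) * s * m + s * s * n
  lemma = solve-∀
  first-shape = λ n a k n≥7 (m , s , coprime , norm , iso , form) →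
    m , s * + n - m * a , coprime , subst (+ 7 ≤_) (sym norm) (+≤+ n≥7) , iso ,
    m , + 0 , s , inj₁ (cong (_+ (s * + n - m * a) ρ) (sym (+-identityˡ m)) , trans (lemma k m a s (+ n)) form)
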